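{- Suppose that $\kappa$ is a strongly inaccessible cardinal and that $X$ is a locally $<\kappa$ Hausdorff $D$-space of size $\kappa$. Then for every $\theta<\kappa$ and every subspace $Z$ of $X$ with $|Z|<\kappa$, there is an open subspace $Y$ of $X$ with $\theta<|Y|<\kappa$ which is a $D$-space and which contains $Z$ as a subspace.
   Context: An open neighbourhood assignment (ONA) in a topological space $(X,\tau)$ is a function $U:X\to\tau$ such that $x\in U(x)$ for all $x\in X$. $X$ is a $D$-space iff for every ONA $U$ of $X$ there is a closed discrete $D\subseteq X$ with $\bigcup\{U(x):x\in D\}=X$. $X$ is locally $<\kappa$ iff there is an ONA $U$ of $X$ with $|U(x)|<\kappa$ for all $x\in X$. -}

module Defs where

open import Level using (Level; _⊔_; suc)
open import Data.Bool.Base using (Bool)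
open import Data.Nat.Base using (ℕ)
open import Data.Product.Base using (Σ; Σ-syntax; ∃-syntax; _×_; _,_; proj₁; proj₂)
open import Data.Sum.Base using (_⊎_)
open import Data.Refinement using (Refinement; value)
open import Function.Base using (id)
open import Function.Bundles using (Injection)
open import Induction.WellFounded using (WellFounded)
open import Relation.Binary.Bundles using (Setoid)
open import Relation.Binary.Core using (Rel)
open import Relation.Binary.PropositionalEquality using (_≡_; _≢_; setoid; _→-setoid_)
open import Relation.Binary.Structures using (IsStrictTotalOrder)
open import Relation.Nullary.Negation using (¬_)
open import Relation.Unary using (Pred; _∈_; _⊆_; _≐_; _∩_; ∁; ∅; U; ⋃; _⊥_; _⊢_)

private
  variable
    a b ℓ : Level

-- The points of a subset. `Refinement` makes the membership proof irrelevant,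
-- so every point occurs once, however many proofs of membership it has.

Points : {A : Set a} → Pred A b → Set (a ⊔ b)
Points {A = A} P = Refinement A P

-- Cardinalities are compared on setoids rather than on types only so that
-- functions A → Bool can be counted up to pointwise equality.

infix 4 _≼_ _≺_

_≼_ : ∀ {a₁ a₂ b₁ b₂} → Setoid a₁ a₂ → Setoid b₁ b₂ → Set (a₁ ⊔ a₂ ⊔ b₁ ⊔ b₂)
S ≼ T = Injection S T

_≺_ : ∀ {a₁ a₂ b₁ b₂} → Setoid a₁ a₂ → Setoid b₁ b₂ → Set (a₁ ⊔ a₂ ⊔ b₁ ⊔ b₂)
S ≺ T = (S ≼ T) × ¬ (T ≼ S)

∣_∣ : Set a → Setoid a a
∣ A ∣ = setoid A

2^_ : Set a → Setoid a a
2^ A = A →-setoid Bool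

-- Cardinals are initial ordinals: well-ordered sets none of whose proper
-- initial segments has as many elements as the whole.

record Cardinal ℓ : Set (suc ℓ) where
  field
    Index              : Set ℓ
    _<_                : Rel Index ℓ
    isStrictTotalOrder : IsStrictTotalOrder _≡_ _<_
    <-wellFounded      : WellFounded _<_
    initial            : ∀ α → ∣ Points (λ β → β < α) ∣ ≺ ∣ Index ∣

  Cofinal : Pred Index ℓ → Set ℓ
  Cofinal C = ∀ α → ∃[ β ] β ∈ C × (α < β ⊎ α ≡ β)

open Cardinal public using (Index)

infix 4 _<ᶜ_

_<ᶜ_ : Cardinal ℓ → Cardinal ℓ → Set ℓ
μ <ᶜ κ = ∣ Index μ ∣ ≺ ∣ Index κ ∣

record StronglyInaccessible {ℓ} (κ : Cardinal ℓ) : Set (suc ℓ) where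
  field
    uncountable : ∣ ℕ ∣ ≺ ∣ Index κ ∣
    -- cf κ = κ
    regular     : ∀ C → Cardinal.Cofinal κ C → ∣ Index κ ∣ ≼ ∣ Points C ∣
    strongLimit : ∀ (μ : Cardinal ℓ) → μ <ᶜ κ → 2^ Index μ ≺ ∣ Index κ ∣

-- Classically the powerset of Carrier is ℓ-small (it is Carrier → Bool), so the
-- unions of families indexed by types in Set ℓ are all the unions of opens.

record Space ℓ : Set (suc (suc ℓ)) where
  field
    Carrier   : Set ℓ
    Open      : Pred (Pred Carrier ℓ) (suc ℓ)
    open-resp : ∀ {V W} → V ≐ W → Open V → Open W
    open-∅    : Open (λ x → Level.Lift ℓ (x ∈ ∅))
    open-U    : Open (λ x → Level.Lift ℓ (x ∈ U))
    open-∩    : ∀ {V W} → Open V → Open W → Open (V ∩ W)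
    open-⋃    : ∀ {I : Set ℓ} (V : I → Pred Carrier ℓ) → (∀ i → Open (V i)) → Open (⋃ I V)

  Closed : Pred (Pred Carrier ℓ) (suc ℓ)
  Closed C = Open (∁ C)

open Space public using (Carrier; Open; Closed)

subspace : (X : Space ℓ) → Pred (Carrier X) ℓ → Space ℓ
subspace {ℓ} X Y = record
  { Carrier   = Points Y
  ; Open      = λ V → Σ[ W ∈ Pred (Carrier X) ℓ ] Open X W × V ≐ (value ⊢ W)
  ; open-resp = λ (V⊆V′ , V′⊆V) (W , oW , V⊆W , W⊆V) →
      W , oW , (λ v → V⊆W (V′⊆V v)) , (λ w → V⊆V′ (W⊆V w))
  ; open-∅    = _ , Space.open-∅ X , id , id
  ; open-U    = _ , Space.open-U X , id , id
  ; open-∩    = λ (W₁ , o₁ , p₁ , q₁) (W₂ , o₂ , p₂ , q₂) →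
      W₁ ∩ W₂ , Space.open-∩ X o₁ o₂
      , (λ (v₁ , v₂) → p₁ v₁ , p₂ v₂) , (λ (w₁ , w₂) → q₁ w₁ , q₂ w₂)
  ; open-⋃    = λ V o →
      ⋃ _ (λ i → proj₁ (o i)) , Space.open-⋃ X _ (λ i → proj₁ (proj₂ (o i)))
      , (λ (i , v) → i , proj₁ (proj₂ (proj₂ (o i))) v)
      , (λ (i , w) → i , proj₂ (proj₂ (proj₂ (o i))) w)
  }

Hausdorff : Space ℓ → Set (suc ℓ)
Hausdorff X = ∀ x y → x ≢ y →
  ∃[ V ] ∃[ W ] Open X V × Open X W × x ∈ V × y ∈ W × V ⊥ W

Discrete : Space ℓ → Set (suc ℓ)
Discrete X = ∀ V → Open X V

-- Open neighbourhood assignments.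

record ONA {ℓ} (X : Space ℓ) : Set (suc ℓ) where
  field
    nbhd   : Carrier X → Pred (Carrier X) ℓ
    isOpen : ∀ x → Open X (nbhd x)
    centre : ∀ x → x ∈ nbhd x

open ONA public using (nbhd)

DSpace : Space ℓ → Set (suc ℓ)
DSpace {ℓ} X = ∀ (N : ONA X) → Σ[ D ∈ Pred (Carrier X) ℓ ]
  Closed X D × Discrete (subspace X D) × (∀ y → ∃[ x ] x ∈ D × y ∈ nbhd N x)

Locally<_ : Cardinal ℓ → Space ℓ → Set (suc ℓ)
(Locally< κ) X = Σ[ N ∈ ONA X ] (∀ x → ∣ Points (nbhd N x) ∣ ≺ ∣ Index κ ∣)

{-# OPTIONS --safe #-}
module Submission where

-- Call a subset of X small if it has fewer than κ elements. In a Hausdorff space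
-- cl A has at most 2^2^|A| points, so closures of small sets are small, and by
-- regularity so is G K = ⋃ {U x | x ∈ K} for small K, where U witnesses that X is
-- locally <κ. Start from K₀ = cl (Z ∪ T), where T is a copy of 2^θ, and put
-- Kₙ₊₁ = cl (G Kₙ). Then Y = ⋃ G Kₙ = ⋃ Kₙ is small and open. It is a D-space, being
-- a countable union of closed subsets of the D-space X: kernels are chosen
-- successively, the n-th one for the part of Kₙ which the previous ones do not cover.

open import Defs
open import Axiom.ExcludedMiddle using (ExcludedMiddle)
open import Data.Bool.Base using (Bool; true; false; if_then_else_)
open import Data.Irrelevant using ([_])
open import Data.Nat.Base using (ℕ; zero; _≤′_; ≤′-refl; ≤′-step)
open import Data.Nat.Properties using (≤-total; ≤⇒≤′)
open import Data.Product.Base using (Σ-syntax; ∃-syntax; _×_; _,_; proj₁; proj₂)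
open import Data.Refinement using (value; _,_; refine)
open import Data.Refinement.Properties using (value-injective)
open import Data.Sum.Base using (_⊎_; inj₁; inj₂; [_,_]′)
open import Function.Base using (_∘_; id)
open import Function.Bundles using (_⤖_; Injection; Func; Bijection; mk↣)
open import Function.Construct.Composition using () renaming (injection to ≼-trans)
open import Induction.WellFounded using (Acc; acc)
open import Level using (Lift; lift; lower; suc)
open import Relation.Binary.Bundles using (Setoid)
open import Relation.Binary.Definitions using (tri<; tri≈; tri>)
import Relation.Binary.Construct.On as On
open import Relation.Binary.PropositionalEquality
  using (_≡_; _≢_; _≗_; refl; sym; trans; cong; subst; isEquivalence)
open import Relation.Binary.Structures using (IsStrictTotalOrder)
open import Relation.Binary.Structures.Biased using (isStrictTotalOrderᶜ)
open import Relation.Nullary.Decidable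
  using (Dec; yes; no; does; recompute; map′; decidable-stable; dec-true; dec-false; toSum)
open import Relation.Nullary.Negation using (¬_; contradiction)
open import Relation.Unary using (Pred; _∈_; _⊆_; _∩_; _∪_; ∁; ∅; ⋃; _⊥_; _⊢_)

-- Classical logic and Cantor's theorem

module Classical {ℓ} (em : ExcludedMiddle (suc ℓ)) where

  em₀ : ExcludedMiddle ℓ
  em₀ {P} = map′ lower lift (em {Lift (suc ℓ) P})

  ¬¬-elim : {P : Set ℓ} → ¬ ¬ P → P
  ¬¬-elim = decidable-stable em₀

  -- Membership is decidable by excluded middle, so the irrelevant proof stored in a point can be
  -- recomputed into a usable one.
  member : {A : Set ℓ} {P : Pred A ℓ} (p : Points P) → value p ∈ P
  member (x , [ p ]) = recompute em₀ p

  does-true : {P : Set (suc ℓ)} → does (em {P}) ≡ true → P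
  does-true {P} eq with em {P}
  ... | yes p = p

  does-true₀ : {P : Set ℓ} → does (em₀ {P}) ≡ true → P
  does-true₀ = lower ∘ does-true

  cantor : (A : Set ℓ) → ¬ (2^ A ≼ ∣ A ∣)
  cantor A g = contradiction d[i]≡true λ eq → true≢false (trans (sym eq) d[i]≡false)
    where
    open Injection g
    -- `d` is true at `j` iff some `f` with code `j` is false at `j`. At the code of `d`,
    -- injectivity makes every such `f` agree with `d`.
    diagonal? : (j : A) → Dec (Σ[ f ∈ (A → Bool) ] to f ≡ j × f j ≡ false)
    diagonal? j = em₀
    d : A → Bool
    d j = does (diagonal? j)
    true≢false : ¬ (true ≡ false)
    true≢false ()
    d[i]≡false : d (to d) ≡ false
    d[i]≡false = dec-false (diagonal? (to d)) λ (f , gf≡gd , fi≡false) →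
      true≢false (trans
        (sym (dec-true (diagonal? (to d)) (f , gf≡gd , fi≡false)))
        (trans (sym (injective gf≡gd (to d))) fi≡false))
    d[i]≡true : d (to d) ≡ true
    d[i]≡true = dec-true (diagonal? (to d)) (d , refl , d[i]≡false)

  singleton : (A : Set ℓ) → ∣ A ∣ ≼ (2^ A)
  singleton A = record
    { to        = λ i j → does (em₀ {i ≡ j})
    ; cong      = λ { refl j → refl }
    ; injective = λ {i} {j} eq → does-true₀ (trans (eq j) (dec-true em₀ refl))
    }

  -- Sets of size below an inaccessible cardinal

  module Regular (κ : Cardinal ℓ) (inaccessible : StronglyInaccessible κ) where
    open Cardinal κ using (_<_; isStrictTotalOrder; <-wellFounded; initial; Cofinal)
    open StronglyInaccessible inaccessible
    open IsStrictTotalOrder isStrictTotalOrder using (compare) renaming (trans to <-trans)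

    -- Without a bound the range of `β` would be cofinal, so by regularity κ would embed in it;
    -- choosing a preimage of each value would then embed κ in `S`.
    bounded-image : (S : Setoid ℓ ℓ) → ¬ (∣ Index κ ∣ ≼ S) → (β : Func S ∣ Index κ ∣) →
                    ∃[ α ] ∀ s → Func.to β s < α
    bounded-image S κ⋠S β with em₀ {∃[ α ] ∀ s → Func.to β s < α}
    ... | yes bounded = bounded
    ... | no unbounded = contradiction (≼-trans (regular Image cofinal) image≼S) κ⋠S
      where
      Image : Pred (Index κ) ℓ
      Image α = ∃[ s ] Func.to β s ≡ α
      image≼S : ∣ Points Image ∣ ≼ S
      image≼S = record
        { to        = proj₁ ∘ member
        ; cong      = λ { refl → Setoid.refl S }
        ; injective = λ {p} {q} eq → value-injective
            (trans (sym (proj₂ (member p))) (trans (Func.cong β eq) (proj₂ (member q))))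
        }
      cofinal : Cofinal Image
      cofinal α = ¬¬-elim λ noneAbove → unbounded (α , λ s → below α noneAbove s)
        where
        below : ∀ α → ¬ (∃[ γ ] γ ∈ Image × (α < γ ⊎ α ≡ γ)) → ∀ s → Func.to β s < α
        below α noneAbove s with compare (Func.to β s) α
        ... | tri< lt _ _ = lt
        ... | tri≈ _ eq _ = contradiction (_ , (s , refl) , inj₂ (sym eq)) noneAbove
        ... | tri> _ _ gt = contradiction (_ , (s , refl) , inj₁ gt) noneAbove

    Segment : Index κ → Set ℓ
    Segment α = Points (λ β → β < α)

    ≼Segment⇒⋡ : ∀ {S : Setoid ℓ ℓ} α → S ≼ ∣ Segment α ∣ → ¬ (∣ Index κ ∣ ≼ S)
    ≼Segment⇒⋡ α S≼α κ≼S = proj₂ (initial α) (≼-trans κ≼S S≼α)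

    least : (P : Pred (Index κ) ℓ) → ∀ {α} → α ∈ P →
            ∃[ μ ] μ ∈ P × (∀ β → β < μ → ¬ (β ∈ P))
    least P p = go (<-wellFounded _) p
      where
      go : ∀ {α} → Acc _<_ α → α ∈ P → ∃[ μ ] μ ∈ P × (∀ β → β < μ → ¬ (β ∈ P))
      go {α} (acc smaller) p with em₀ {∃[ β ] β < α × β ∈ P}
      ... | yes (β , β<α , q) = go (smaller β<α) q
      ... | no none = α , p , λ β β<α q → none (β , β<α , q)

    -- Minimality of `α` is what makes the segment an initial ordinal: if it embedded in its part
    -- below some `p`, so would `S`.
    segmentCardinal : (S : Setoid ℓ ℓ) (α : Index κ) → S ≼ ∣ Segment α ∣ →
                      (∀ β → β < α → ¬ (S ≼ ∣ Segment β ∣)) → Cardinal ℓ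
    segmentCardinal S α S≼α minimal = record
      { Index              = Segment α
      ; _<_                = λ p q → value p < value q
      ; isStrictTotalOrder = isStrictTotalOrderᶜ record
          { isEquivalence = isEquivalence
          ; trans         = <-trans
          ; compare       = comparePoints
          }
      ; <-wellFounded      = On.wellFounded value <-wellFounded
      ; initial            = λ p → mk↣ value-injective , λ α≼p →
          minimal (value p) (member p) (≼-trans S≼α (≼-trans α≼p (mk↣ (inSegment p))))
      }
      where
      comparePoints : (p q : Segment α) → _
      comparePoints p q with compare (value p) (value q)
      ... | tri< lt ≢ ≯ = tri< lt (≢ ∘ cong value) ≯
      ... | tri≈ ≮ eq ≯ = tri≈ ≮ (value-injective eq) ≯
      ... | tri> ≮ ≢ gt = tri> ≮ (≢ ∘ cong value) gt
      toSegment : (p : Segment α) → Points (λ q → value q < value p) → Segment (value p)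
      toSegment p (q , [ q<p ]) = value q , [ q<p ]
      inSegment : ∀ p {q r} → toSegment p q ≡ toSegment p r → q ≡ r
      inSegment p eq = value-injective (value-injective (cong value eq))

    -- Prepares for `strongLimit`, which speaks of initial ordinals only. An injection of `S` into κ
    -- has bounded range, so `S` embeds in some segment; the least such segment is the required
    -- cardinal.
    cardinality : (S : Setoid ℓ ℓ) → S ≺ ∣ Index κ ∣ → Σ[ μ ∈ Cardinal ℓ ] S ≼ ∣ Index μ ∣ × μ <ᶜ κ
    cardinality S (S≼κ , κ⋠S) =
      let α , f<α          = bounded-image S κ⋠S (Injection.function S≼κ)
          μ , S≼μ , minimal = least (λ α → S ≼ ∣ Segment α ∣) {α} record
            { to        = λ s → Injection.to S≼κ s , [ f<α s ]
            ; cong      = value-injective ∘ Injection.cong S≼κ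
            ; injective = Injection.injective S≼κ ∘ cong value
            }
      in segmentCardinal S μ S≼μ minimal , S≼μ , initial μ

    module Bounded {A : Set ℓ} (h : A ⤖ Index κ) where
      open Bijection h using (to; injective)

      -- By regularity this amounts to having fewer than κ points, and bounds are easier to combine
      -- than injections.
      Bounded : Pred A ℓ → Set ℓ
      Bounded P = ∃[ α ] ∀ {x} → x ∈ P → to x < α

      points≼ : (P : Pred A ℓ) → ∣ Points P ∣ ≼ ∣ Index κ ∣
      points≼ P = mk↣ {to = to ∘ value} (value-injective ∘ injective)

      bounded⇒≺ : ∀ {P} → Bounded P → ∣ Points P ∣ ≺ ∣ Index κ ∣
      bounded⇒≺ {P} (α , <α) = points≼ P , ≼Segment⇒⋡ α
        (mk↣ {to = λ p → to (value p) , [ <α (member p) ]}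
          (value-injective ∘ injective ∘ cong value))

      ⋡⇒bounded : ∀ {P} → ¬ (∣ Index κ ∣ ≼ ∣ Points P ∣) → Bounded P
      ⋡⇒bounded {P} κ⋠P =
        let α , <α = bounded-image ∣ Points P ∣ κ⋠P (Injection.function (points≼ P))
        in α , λ {x} p → <α (x , [ p ])

      -- The bounds of the `V i` form a family indexed by `I`, in which κ does not embed, so they
      -- have a common bound themselves.
      bounded-⋃ : ∀ {I : Set ℓ} (V : I → Pred A ℓ) → ¬ (∣ Index κ ∣ ≼ ∣ I ∣) →
                  (∀ i → Bounded (V i)) → Bounded (⋃ I V)
      bounded-⋃ {I} V κ⋠I bounded =
        let γ , <γ = bounded-image ∣ I ∣ κ⋠I
              (record { to = λ i → proj₁ (bounded i) ; cong = cong _ })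
        in γ , λ (i , v) → <-trans (proj₂ (bounded i) v) (<γ i)

      bounded-∪ : ∀ {P Q} → Bounded P → Bounded Q → Bounded (P ∪ Q)
      bounded-∪ (α , <α) (β , <β) with compare α β
      ... | tri< α<β _ _ = β , [ (λ p → <-trans (<α p) α<β) , <β ]′
      ... | tri≈ _ refl _ = β , [ <α , <β ]′
      ... | tri> _ _ β<α = α , [ <α , (λ q → <-trans (<β q) β<α) ]′

  -- Closures and their size

  module Topology (X : Space ℓ) where
    open Space X using (open-resp; open-∅; open-∩; open-⋃)

    open-∪ : ∀ {V W} → Open X V → Open X W → Open X (V ∪ W)
    open-∪ {V} {W} oV oW = open-resp
      ( (λ { (lift true , v) → inj₁ v ; (lift false , w) → inj₂ w })
      , [ (λ v → lift true , v) , (λ w → lift false , w) ]′)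
      (open-⋃ (λ (b : Lift ℓ Bool) → if lower b then V else W)
        λ { (lift true) → oV ; (lift false) → oW })

    Exterior : Pred (Carrier X) ℓ → Carrier X → Set (suc ℓ)
    Exterior A x = Σ[ V ∈ Pred (Carrier X) ℓ ] Open X V × x ∈ V × V ⊥ A

    -- The exterior as an ℓ-small predicate: the union over all points x of one chosen
    -- open neighbourhood of x disjoint from A, if there is one.
    chosen : ∀ {A x} → Dec (Exterior A x) → Pred (Carrier X) ℓ
    chosen (yes (V , _)) = V
    chosen (no _)        = λ x → Lift ℓ (x ∈ ∅)

    exterior : Pred (Carrier X) ℓ → Pred (Carrier X) ℓ
    exterior A = ⋃ (Carrier X) λ x → chosen (em {Exterior A x})

    exterior-open : ∀ A → Open X (exterior A)
    exterior-open A = open-⋃ _ λ x → chosen-open (em {Exterior A x})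
      where
      chosen-open : ∀ {x} (e : Dec (Exterior A x)) → Open X (chosen e)
      chosen-open (yes (_ , oV , _)) = oV
      chosen-open (no _)             = open-∅

    exterior-⊥ : ∀ A → exterior A ⊥ A
    exterior-⊥ A ((x , v) , a) = disjoint (em {Exterior A x}) v a
      where
      disjoint : ∀ {x y} (e : Dec (Exterior A x)) → y ∈ chosen e → y ∈ A → y ∈ ∅ {A = Carrier X}
      disjoint (yes (_ , _ , _ , V⊥A)) v a = V⊥A (v , a)

    exterior-largest : ∀ A {x} → Exterior A x → x ∈ exterior A
    exterior-largest A {x} e = x , centred (em {Exterior A x})
      where
      centred : (d : Dec (Exterior A x)) → x ∈ chosen d
      centred (yes (_ , _ , v , _)) = v
      centred (no ¬e)               = contradiction e ¬e

    closure : Pred (Carrier X) ℓ → Pred (Carrier X) ℓ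
    closure A = ∁ (exterior A)

    closure-closed : ∀ A → Closed X (closure A)
    closure-closed A = open-resp ((λ e ¬e → ¬e e) , ¬¬-elim) (exterior-open A)

    closure-⊇ : ∀ A → A ⊆ closure A
    closure-⊇ A a e = exterior-⊥ A (e , a)

    -- A point of the closure is determined by the family of traces on `A` of its open
    -- neighbourhoods. Through `f` a trace becomes a subset of `B`, through `g` a point of `C`, and
    -- the family a subset of `C`.
    closure≼2^2^ : Hausdorff X → (A : Pred (Carrier X) ℓ) {B C : Set ℓ} →
                   ∣ Points A ∣ ≼ ∣ B ∣ → (2^ B) ≼ ∣ C ∣ → ∣ Points (closure A) ∣ ≼ (2^ C)
    closure≼2^2^ hausdorff A {B} {C} f g = record
      { to        = traces ∘ value
      ; cong      = λ { refl c → refl }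
      ; injective = λ {p} {q} eq → value-injective (¬¬-elim λ p≢q → inseparable p≢q (member q) eq)
      }
      where
      module f = Injection f
      module g = Injection g

      -- The subset of B corresponding to V ∩ A.
      trace : Pred (Carrier X) ℓ → B → Bool
      trace V b = does (em₀ {Σ[ a ∈ Points A ] f.to a ≡ b × value a ∈ V})

      traces : Carrier X → C → Bool
      traces x c = does (em {Σ[ V ∈ Pred (Carrier X) ℓ ] Open X V × x ∈ V × g.to (trace V) ≡ c})

      -- Separate `x` and `y` by disjoint `V` and `W`. If the families agree, some neighbourhood
      -- `V′` of `y` has the same trace as `V`, so `V′ ∩ W` is a neighbourhood of `y` that misses
      -- `A`.
      inseparable : ∀ {x y} → x ≢ y → y ∈ closure A → ¬ (traces x ≗ traces y)
      inseparable {x} {y} x≢y y∈clA eq =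
        let V , W , oV , oW , x∈V , y∈W , V⊥W = hausdorff x y x≢y
            c = g.to (trace V)
            V′ , oV′ , y∈V′ , same = does-true
              (trans (sym (eq c)) (dec-true em (V , oV , x∈V , refl)))
            V′∩A⊆V : ∀ {z} → z ∈ V′ → z ∈ A → z ∈ V
            V′∩A⊆V {z} z∈V′ z∈A =
              let z′ , fz′≡fz , z′∈V = does-true₀
                    (trans (sym (g.injective same (f.to (z , [ z∈A ]))))
                      (dec-true em₀ ((z , [ z∈A ]) , refl , z∈V′)))
              in subst V (cong value (f.injective fz′≡fz)) z′∈V
        in y∈clA (exterior-largest A
             ( V′ ∩ W , open-∩ oV′ oW , (y∈V′ , y∈W)
             , λ ((z∈V′ , z∈W) , z∈A) → V⊥W (V′∩A⊆V z∈V′ z∈A , z∈W)))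

    -- Closed discrete sets and kernels

    -- Equivalent to being closed and discrete as a subspace, by the next two lemmas, but free of
    -- subspaces and convenient for finite unions.
    ClosedDiscrete : Pred (Carrier X) ℓ → Set (suc ℓ)
    ClosedDiscrete D = ∀ {A} → A ⊆ D → Closed X A

    closedDiscrete⇒ : ∀ {D} → ClosedDiscrete D → Closed X D × Discrete (subspace X D)
    closedDiscrete⇒ {D} cd = cd id , λ V →
      -- The points of `D` outside `V`: the complement of this closed set cuts `V` out of `D`.
      let A : Pred (Carrier X) ℓ
          A x = Σ[ p ∈ Points D ] value p ≡ x × ¬ (p ∈ V)
      in ∁ A , cd (λ { (p , refl , _) → member p })
         , (λ v (q , eq , ¬v) → ¬v (subst V (sym (value-injective eq)) v))
         , (λ ¬a → ¬¬-elim λ ¬v → ¬a (_ , refl , ¬v))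

    closedDiscrete⇐ : ∀ {D} → Closed X D → Discrete (subspace X D) → ClosedDiscrete D
    closedDiscrete⇐ {D} closed discrete {A} A⊆D =
      let W , oW , ∁A⊆W , W⊆∁A = discrete (value ⊢ ∁ A)
          ∁A⊆ : ∁ A ⊆ ∁ D ∪ W
          ∁A⊆ {x} ¬a = [ (λ d → inj₂ (∁A⊆W {x , [ d ]} ¬a)) , inj₁ ]′ (toSum (em₀ {x ∈ D}))
      in open-resp
           ( [ (λ ¬d a → ¬d (A⊆D a)) , (λ w a → W⊆∁A {_ , [ A⊆D a ]} w a) ]′
           , ∁A⊆)
           (open-∪ closed oW)

    closedDiscrete-∪ : ∀ {D E} → ClosedDiscrete D → ClosedDiscrete E → ClosedDiscrete (D ∪ E)
    closedDiscrete-∪ {D} {E} cdD cdE {A} A⊆D∪E = open-resp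
      ( (λ (¬d , ¬e) a → [ (λ d → ¬d (a , d)) , (λ e → ¬e (a , e)) ]′ (A⊆D∪E a))
      , (λ ¬a → ¬a ∘ proj₁ , ¬a ∘ proj₁))
      (open-∩ (cdD {A ∩ D} proj₂) (cdE {A ∩ E} proj₂))

    -- The neighbourhoods extend to all of `X` by giving each point outside `F` the open set `∁ F`.
    -- That set covers no point of `F`, so the part of the kernel inside `F` covers `F`.
    closedKernel : DSpace X → (F : Pred (Carrier X) ℓ) → Closed X F →
      (M : Points F → Pred (Carrier X) ℓ) → (∀ p → Open X (M p)) → (∀ p → value p ∈ M p) →
      Σ[ D ∈ Pred (Carrier X) ℓ ] ClosedDiscrete D × D ⊆ F ×
        (∀ {y} → y ∈ F → Σ[ d ∈ Points F ] value d ∈ D × y ∈ M d)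
    closedKernel dspace F closed M M-open M-centre =
      let E , E-closed , E-discrete , E-covers = dspace assignment
          E-cd = closedDiscrete⇐ E-closed E-discrete
      in E ∩ F , (λ A⊆ → E-cd (proj₁ ∘ A⊆)) , proj₂
         , λ {y} f → let x , e , n = E-covers y in inF x e f em₀ n
      where
      nbhdBy : ∀ {x} → Dec (x ∈ F) → Pred (Carrier X) ℓ
      nbhdBy (yes f) = M (_ , [ f ])
      nbhdBy (no _)  = ∁ F
      nbhdBy-open : ∀ {x} (f? : Dec (x ∈ F)) → Open X (nbhdBy f?)
      nbhdBy-open (yes f) = M-open _
      nbhdBy-open (no _)  = closed
      nbhdBy-centre : ∀ {x} (f? : Dec (x ∈ F)) → x ∈ nbhdBy f?
      nbhdBy-centre (yes f) = M-centre _
      nbhdBy-centre (no ¬f) = ¬f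
      assignment : ONA X
      assignment = record
        { nbhd   = λ x → nbhdBy (em₀ {x ∈ F})
        ; isOpen = λ x → nbhdBy-open em₀
        ; centre = λ x → nbhdBy-centre em₀
        }
      inF : ∀ {E : Pred (Carrier X) ℓ} {y} x → x ∈ E → y ∈ F → (f? : Dec (x ∈ F)) →
            y ∈ nbhdBy f? → Σ[ d ∈ Points F ] value d ∈ E ∩ F × y ∈ M d
      inF x e _ (yes f) n = (x , [ f ]) , (e , f) , n
      inF x e f (no _)  n = contradiction f n

  -- Countable unions of closed subsets of a D-space

  Fσ-DSpace : (X : Space ℓ) → DSpace X → (Y : Pred (Carrier X) ℓ) (K : ℕ → Pred (Carrier X) ℓ) →
              (∀ n → Closed X (K n)) → (∀ n → K n ⊆ Y) → Y ⊆ ⋃ ℕ K → DSpace (subspace X Y)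
  Fσ-DSpace X dspace Y K K-closed K⊆Y Y⊆⋃K N =
    (value ⊢ D) , proj₁ D-closedDiscrete , proj₂ D-closedDiscrete , D-covers
    where
    open Space X using (open-resp; open-∅; open-∩; open-⋃)
    open Topology X

    -- Open sets of `X` whose traces on `Y` are the given neighbourhoods. The stages live in `X`,
    -- where the D-space property is available.
    M : Points Y → Pred (Carrier X) ℓ
    M p = proj₁ (ONA.isOpen N p)
    M-open : ∀ p → Open X (M p)
    M-open p = proj₁ (proj₂ (ONA.isOpen N p))
    N⊆M : ∀ p {q} → q ∈ nbhd N p → value q ∈ M p
    N⊆M p = proj₁ (proj₂ (proj₂ (ONA.isOpen N p)))
    M⊆N : ∀ p {q} → value q ∈ M p → q ∈ nbhd N p
    M⊆N p = proj₂ (proj₂ (proj₂ (ONA.isOpen N p)))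

    record Stage : Set (suc ℓ) where
      field
        kernel         : Pred (Carrier X) ℓ
        covered        : Pred (Carrier X) ℓ
        closedDiscrete : ClosedDiscrete kernel
        covered-open   : Open X covered
        covers         : ∀ {y} → y ∈ covered → Σ[ d ∈ Points Y ] value d ∈ kernel × y ∈ M d
    open Stage

    module Step (n : ℕ) (s : Stage) where
      rest : Pred (Carrier X) ℓ
      rest = K n ∩ ∁ (covered s)

      rest-closed : Closed X rest
      rest-closed = open-resp
        ( [ (λ ¬k (k , _) → ¬k k) , (λ v (_ , ¬v) → ¬v v) ]′
        , λ ¬rest → split ¬rest em₀)
        (open-∪ (K-closed n) (covered-open s))
        where
        split : ∀ {x} → ¬ (x ∈ rest) → Dec (x ∈ K n) → x ∈ ∁ (K n) ∪ covered s
        split ¬rest (yes k) = inj₂ (¬¬-elim λ ¬v → ¬rest (k , ¬v))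
        split ¬rest (no ¬k) = inj₁ ¬k

      inY : Points rest → Points Y
      inY = refine (λ r → K⊆Y n (proj₁ r))

      restKernel = closedKernel dspace rest rest-closed (M ∘ inY) (M-open ∘ inY)
        λ p → N⊆M (inY p) (ONA.centre N (inY p))

      E : Pred (Carrier X) ℓ
      E = proj₁ restKernel
      E⊆rest : E ⊆ rest
      E⊆rest = proj₁ (proj₂ (proj₂ restKernel))

      new : Pred (Carrier X) ℓ
      new = ⋃ (Σ[ d ∈ Points rest ] value d ∈ E) λ (d , _) → M (inY d)

      next : Stage
      next = record
        { kernel         = kernel s ∪ E
        ; covered        = covered s ∪ new
        ; closedDiscrete = closedDiscrete-∪ (closedDiscrete s) (proj₁ (proj₂ restKernel))
        ; covered-open   = open-∪ (covered-open s) (open-⋃ _ λ (d , _) → M-open (inY d))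
        ; covers         = [ (λ v → let d , k , m = covers s v in d , inj₁ k , m)
                           , (λ ((d , e) , m) → inY d , inj₂ e , m) ]′
        }

      K⊆covered : ∀ {y} → y ∈ K n → y ∈ covered next
      K⊆covered {y} k with em₀ {y ∈ covered s}
      ... | yes v = inj₁ v
      ... | no ¬v = let d , e , m = proj₂ (proj₂ (proj₂ restKernel)) (k , ¬v) in inj₂ ((d , e) , m)

    stage : ℕ → Stage
    stage zero = record
      { kernel         = λ x → Lift ℓ (x ∈ ∅)
      ; covered        = λ x → Lift ℓ (x ∈ ∅)
      ; closedDiscrete = λ {A} A⊆∅ → open-resp
          ((λ _ a → lower (A⊆∅ a)) , (λ _ → lift _)) (Space.open-U X)
      ; covered-open   = open-∅
      ; covers         = λ ()
      }
    stage (ℕ.suc n) = Step.next n (stage n)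

    kernel-mono : ∀ {m n} → m ≤′ n → kernel (stage m) ⊆ kernel (stage n)
    kernel-mono ≤′-refl       k = k
    kernel-mono (≤′-step m≤n) k = inj₁ (kernel-mono m≤n k)

    covered-mono : ∀ {m n} → m ≤′ n → covered (stage m) ⊆ covered (stage n)
    covered-mono ≤′-refl       v = v
    covered-mono (≤′-step m≤n) v = inj₁ (covered-mono m≤n v)

    -- Points of the kernel added after stage m lie outside what is covered at stage m.
    later : ∀ {m n} → m ≤′ n → covered (stage m) ∩ kernel (stage n) ⊆ kernel (stage m)
    later ≤′-refl       (_ , k)      = k
    later (≤′-step m≤n) (v , inj₁ k) = later m≤n (v , k)
    later (≤′-step {n} m≤n) (v , inj₂ e) =
      contradiction (covered-mono m≤n v) (proj₂ (Step.E⊆rest n (stage n) e))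

    settled : ∀ m n → covered (stage m) ∩ kernel (stage n) ⊆ kernel (stage m)
    settled m n (v , k) =
      [ (λ m≤n → later (≤⇒≤′ m≤n) (v , k)) , (λ n≤m → kernel-mono (≤⇒≤′ n≤m) k) ]′ (≤-total m n)

    D : Pred (Carrier X) ℓ
    D = ⋃ ℕ (kernel ∘ stage)

    eventually : ∀ {x} → x ∈ Y → ∃[ n ] x ∈ covered (stage n)
    -- `K n` is treated in passing from stage `n` to stage `n + 1`, hence the successor.
    eventually y = let n , k = Y⊆⋃K y in ℕ.suc n , Step.K⊆covered n (stage n) k

    -- Inside the open set covered (stage n), a subset of D agrees with its
    -- intersection with the closed discrete set kernel (stage n).
    D-closedDiscrete = Topology.closedDiscrete⇒ (subspace X Y) {value ⊢ D} λ {A} A⊆D →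
      let A′ : ℕ → Pred (Carrier X) ℓ
          A′ n x = x ∈ kernel (stage n) × Σ[ p ∈ Points Y ] value p ≡ x × p ∈ A
          W : Lift ℓ ℕ → Pred (Carrier X) ℓ
          W (lift n) = covered (stage n) ∩ ∁ (A′ n)
      in ⋃ (Lift ℓ ℕ) W
         , open-⋃ W (λ (lift n) → open-∩ (covered-open (stage n)) (closedDiscrete (stage n) proj₁))
         , (λ {p} ¬a → let n , v = eventually (member p) in
              lift n , v , λ (_ , q , eq , a) → ¬a (subst A (value-injective eq) a))
         , (λ (lift n , v , ¬a′) a → let m , k = A⊆D a in
              ¬a′ (settled n m (v , k) , _ , refl , a))

    D-covers : ∀ y → ∃[ x ] x ∈ (value ⊢ D) × y ∈ nbhd N x
    D-covers y =
      let n , v     = eventually (member y)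
          d , k , m = covers (stage n) v
      in d , (n , k) , M⊆N d m

-- Construction of the open D-subspace

theorem3p3 : ∀ {ℓ} → ExcludedMiddle (suc ℓ) →
    ∀ (κ : Cardinal ℓ) → StronglyInaccessible κ →
    ∀ (X : Space ℓ) → (Locally< κ) X → Hausdorff X → DSpace X → Carrier X ⤖ Index κ →
    ∀ (θ : Cardinal ℓ) → θ <ᶜ κ →
    ∀ (Z : Pred (Carrier X) ℓ) → ∣ Points Z ∣ ≺ ∣ Index κ ∣ →
    Σ[ Y ∈ Pred (Carrier X) ℓ ]
    Open X Y × ∣ Index θ ∣ ≺ ∣ Points Y ∣ × ∣ Points Y ∣ ≺ ∣ Index κ ∣ ×
    DSpace (subspace X Y) × Z ⊆ Y
theorem3p3 {ℓ} em κ inaccessible X (N , N-small) hausdorff dspace h θ θ<κ Z Z-small =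
  -- `Y` contains a copy of 2^θ, so an embedding of `Y` in θ would contradict Cantor's theorem.
  Y , Y-open , (≼-trans (singleton (Index θ)) 2^θ≼Y , λ Y≼θ → cantor (Index θ) (≼-trans 2^θ≼Y Y≼θ))
    , bounded⇒≺ Y-bounded
    -- `G (K n)` lies in its closure `K (n + 1)`, so the closed sets `K n` exhaust `Y`.
    , Fσ-DSpace X dspace Y K K-closed (λ n k → lift n , K⊆G (K n) k)
        (λ (lift n , g) → ℕ.suc n , closure-⊇ _ g)
    , λ z → Z∪T⊆Y (inj₁ z)
  where
  open Classical em
  open Regular κ inaccessible
  open Bounded h
  open Topology X
  open Space X using (open-⋃)
  open StronglyInaccessible inaccessible using (uncountable; strongLimit)

  2^θ≺κ : (2^ Index θ) ≺ ∣ Index κ ∣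
  2^θ≺κ = strongLimit θ θ<κ
  module e = Injection (proj₁ 2^θ≺κ)
  module h = Bijection h

  preimage : Index κ → Carrier X
  preimage α = proj₁ (h.surjective α)
  to-preimage : ∀ α → h.to (preimage α) ≡ α
  to-preimage α = proj₂ (h.surjective α) refl

  T : Pred (Carrier X) ℓ
  T x = Σ[ f ∈ (Index θ → Bool) ] h.to x ≡ e.to f

  T-bounded : Bounded T
  T-bounded =
    let α , <α = bounded-image (2^ Index θ) (proj₂ 2^θ≺κ) e.function
    in α , λ (f , eq) → subst (λ β → Cardinal._<_ κ β α) (sym eq) (<α f)

  -- The strong limit property is used twice: `A` embeds in some μ below κ and 2^μ in some ν below
  -- κ, so the closure embeds in 2^ν, in which κ does not.
  closure-bounded : ∀ {A} → Bounded A → Bounded (closure A)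
  closure-bounded {A} bounded =
    let μ , A≼μ , μ<κ     = cardinality ∣ Points A ∣ (bounded⇒≺ bounded)
        ν , 2^μ≼ν , ν<κ   = cardinality (2^ Index μ) (strongLimit μ μ<κ)
    in ⋡⇒bounded λ κ≼clA →
         proj₂ (strongLimit ν ν<κ) (≼-trans κ≼clA (closure≼2^2^ hausdorff A A≼μ 2^μ≼ν))

  G : Pred (Carrier X) ℓ → Pred (Carrier X) ℓ
  G P = ⋃ (Points P) (nbhd N ∘ value)

  K⊆G : ∀ P → P ⊆ G P
  K⊆G P {x} p = (x , [ p ]) , ONA.centre N x

  G-bounded : ∀ {P} → Bounded P → Bounded (G P)
  G-bounded bounded = bounded-⋃ _ (proj₂ (bounded⇒≺ bounded)) λ p →
    ⋡⇒bounded (proj₂ (N-small (value p)))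

  K : ℕ → Pred (Carrier X) ℓ
  K zero      = closure (Z ∪ T)
  K (ℕ.suc n) = closure (G (K n))

  K-closed : ∀ n → Closed X (K n)
  K-closed zero      = closure-closed _
  K-closed (ℕ.suc n) = closure-closed _

  K-bounded : ∀ n → Bounded (K n)
  K-bounded zero      = closure-bounded (bounded-∪ (⋡⇒bounded (proj₂ Z-small)) T-bounded)
  K-bounded (ℕ.suc n) = closure-bounded (G-bounded (K-bounded n))

  -- Written with the sets `G (K n)` rather than `K n` to be visibly open. The lift puts the index
  -- type in `Set ℓ`, as `open-⋃` requires.
  Y : Pred (Carrier X) ℓ
  Y = ⋃ (Lift ℓ ℕ) (G ∘ K ∘ lower)

  Y-open : Open X Y
  Y-open = open-⋃ _ λ n → open-⋃ _ λ p → ONA.isOpen N (value p)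

  Y-bounded : Bounded Y
  Y-bounded = bounded-⋃ _
    -- Uncountability enters here: with regularity it bounds countably many bounds at once.
    (λ κ≼ℕ → proj₂ uncountable (≼-trans κ≼ℕ (mk↣ {to = lower} λ { refl → refl })))
    (λ n → G-bounded (K-bounded (lower n)))

  Z∪T⊆Y : Z ∪ T ⊆ Y
  Z∪T⊆Y zt = lift zero , K⊆G (K zero) (closure-⊇ (Z ∪ T) zt)

  2^θ≼Y : (2^ Index θ) ≼ ∣ Points Y ∣
  2^θ≼Y = record
    { to        = λ f → preimage (e.to f) , [ Z∪T⊆Y (inj₂ (f , to-preimage (e.to f))) ]
    ; cong      = λ eq → value-injective (cong preimage (e.cong eq))
    ; injective = λ {f} {g} eq → e.injective
        (trans (sym (to-preimage (e.to f))) (trans (cong (h.to ∘ value) eq) (to-preimage (e.to g))))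
    }
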